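{- Let $k\geq 1$ be an integer and let $m$ be the smallest integer such that $\binom{m}{2} \geq 2k$ if $k$ is odd, and $\binom{m}{2}\geq 2k+1$ if $k$ is even. Then $2 < \mathrm{Dist}(\Omega_{2k}) \leq m$.
   Context: The orthogonality graph $\Omega_{2k}$ has vertex set $\mathbb{Z}_2^{2k}$ (bitstrings of length $2k$), with two vertices adjacent if and only if their bitstrings differ in exactly $k$ positions. A labeling $f: V(G)\to\{1,\dots,d\}$ of a graph $G$ is $d$-distinguishing if the only automorphism of $G$ preserving every label class is the identity; $\mathrm{Dist}(G)$ is the least $d$ for which $G$ has a $d$-distinguishing labeling. -}

module Defs where

open import Data.Nat using (ℕ; zero; suc; _+_; _*_; _≤_; _<_)
open import Data.Nat.Combinatorics using (_C_)
open import Data.Nat.Base using (_%_)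
open import Data.Bool using (Bool; true; false; if_then_else_; _xor_)
open import Data.Vec using (Vec; []; _∷_)
open import Data.Fin using (Fin)
open import Data.Product using (Σ; _×_; ∃)
open import Relation.Binary.PropositionalEquality using (_≡_)
open import Relation.Nullary using (¬_)
open import Function.Bundles using (_↔_; Inverse)

hamming : ∀ {n} → Vec Bool n → Vec Bool n → ℕ
hamming []       []       = 0
hamming (x ∷ xs) (y ∷ ys) = (if x xor y then 1 else 0) + hamming xs ys

record Graph : Set₁ where
  field
    V   : Set
    Adj : V → V → Set

Ω : ℕ → Graph
Ω k = record { V = Vec Bool (2 * k) ; Adj = λ u v → hamming u v ≡ k }

IsAutomorphism : (G : Graph) → (Graph.V G ↔ Graph.V G) → Set
IsAutomorphism G σ = ∀ u v → (Adj u v → Adj (to u) (to v)) × (Adj (to u) (to v) → Adj u v)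
  where open Graph G
        open Inverse σ

IsDistinguishing : (G : Graph) (d : ℕ) → (Graph.V G → Fin d) → Set
IsDistinguishing G d f =
  (σ : V ↔ V) → IsAutomorphism G σ → (∀ v → f (Inverse.to σ v) ≡ f v) →
  ∀ v → Inverse.to σ v ≡ v
  where open Graph G

HasDistinguishingLabeling : Graph → ℕ → Set
HasDistinguishingLabeling G d = Σ (Graph.V G → Fin d) (IsDistinguishing G d)

IsDist : Graph → ℕ → Set
IsDist G d = HasDistinguishingLabeling G d × (∀ d' → d' < d → ¬ HasDistinguishingLabeling G d')

threshold : ℕ → ℕ
threshold k with k % 2
... | zero = 2 * k + 1
... | suc _ = 2 * k

IsLeastM : ℕ → ℕ → Set
IsLeastM k m = threshold k ≤ m C 2 × (∀ m' → threshold k ≤ m' C 2 → m ≤ m')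

{-# OPTIONS --safe #-}

-- Complementary bitstrings v and comp v have the same neighbours in Ω, and no other vertices
-- share their neighbourhood, so automorphisms permute the twin classes {v , comp v}.
--
-- Lower bound: with at most two labels, either two twins have the same label and can be
-- swapped, or every automorphism of the graph of twin classes lifts to Ω preserving labels.
--
-- Upper bound: give twins distinct labels; the unordered pair of labels is then one of m C 2
-- colours of the twin class. It suffices to colour the classes rigidly. If an automorphism
-- fixes (the class of) c and those of the spokes c + e₀ + eⱼ, j ≥ 2, then it fixes every
-- neighbour x of c: adjacency of x to a spoke says whether x + c differs at 0 and j, and the
-- remaining coordinate 1 follows since x + c has weight k. These neighbours in turn separate
-- the vertices v at even distance from c. So 2k − 1 singleton classes and one colour for the
-- rest are enough for the vertices of even weight. For odd k an odd vertex is determined by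
-- its neighbours, which are even. For even k the two parities are different components; both
-- use the same colours, except that c = 0 and c = e₀ get colours of their own.
module Submission where

open import Defs
import Data.Bool
open import Data.Bool using (Bool; true; false; not; _xor_; if_then_else_)
open import Data.Bool.Properties using (xor-same; xor-assoc; xor-comm; xor-identityʳ; not-involutive; not-distribˡ-xor; not-distribʳ-xor; ¬-not; not-injective; xor-annihilates-not)
open import Data.Empty using (⊥; ⊥-elim)
import Data.Fin as Fin
open import Data.Fin using (Fin; zero; suc)
import Data.Fin.Properties as Fin
import Data.Nat
open import Data.Nat using (ℕ; zero; suc; _+_; _*_; _≤_; _<_; z≤n; s≤s)
open import Data.Nat.Combinatorics using (_C_; nC1≡n; nCk+nC[k+1]≡[n+1]C[k+1])
open import Data.Nat.DivMod using (_/_; _%_; m%n<n; m≡m%n+[m/n]*n)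
open import Data.Nat.Properties as ℕ using (+-suc; +-comm; +-assoc; suc-injective)
import Data.Product
open import Data.Product using (Σ; ∃; _×_; _,_; proj₁; proj₂)
open import Data.Sum using (_⊎_; inj₁; inj₂)
open import Data.Vec using (Vec; []; _∷_; map; replicate; zipWith; lookup; updateAt)
open import Data.Vec.Properties using (zipWith-assoc; zipWith-comm; ≡-dec; lookup-zipWith; lookup-map; lookup-replicate; lookup∘updateAt′; tabulate∘lookup; tabulate-cong)
open import Function using (_∘_)
open import Function.Bundles using (_↔_; Inverse; mk↔ₛ′)
open import Relation.Binary.PropositionalEquality
open import Relation.Nullary using (¬_; Dec; yes; no; contradiction)
open import Relation.Nullary.Decidable using (map′; _×-dec_; _⊎-dec_; _→-dec_; ¬?; decidable-stable)

Bits : ℕ → Set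
Bits = Vec Bool

private variable
  n : ℕ

-- Bitstrings

infixl 6 _⊕_

_⊕_ : Bits n → Bits n → Bits n
_⊕_ = zipWith _xor_

comp : Bits n → Bits n
comp = map not

𝟎 : Bits n
𝟎 = replicate _ false

b2n : Bool → ℕ
b2n b = if b then 1 else 0

wt : Bits n → ℕ
wt []       = 0
wt (x ∷ xs) = b2n x + wt xs

odd : ℕ → Bool
odd zero    = false
odd (suc m) = not (odd m)

par : Bits n → Bool
par u = odd (wt u)

flip : Fin n → Bits n → Bits n
flip i u = updateAt u i not

infix 4 _≈_ _≟_

_≟_ : (u v : Bits n) → Dec (u ≡ v)
_≟_ = ≡-dec Data.Bool._≟_

-- The twin relation. By `~-≈ˡ` and `neighbours⊆⇒≈` below it amounts to having the same neighbours.
_≈_ : Bits n → Bits n → Set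
u ≈ v = u ≡ v ⊎ u ≡ comp v

hamming-wt : (u v : Bits n) → hamming u v ≡ wt (u ⊕ v)
hamming-wt []       []       = refl
hamming-wt (x ∷ xs) (y ∷ ys) = cong (b2n (x xor y) +_) (hamming-wt xs ys)

⊕-assoc : (u v w : Bits n) → (u ⊕ v) ⊕ w ≡ u ⊕ (v ⊕ w)
⊕-assoc = zipWith-assoc xor-assoc

⊕-comm : (u v : Bits n) → u ⊕ v ≡ v ⊕ u
⊕-comm = zipWith-comm xor-comm

⊕-self : (u : Bits n) → u ⊕ u ≡ 𝟎
⊕-self []       = refl
⊕-self (x ∷ xs) = cong₂ _∷_ (xor-same x) (⊕-self xs)

⊕-identityˡ : (u : Bits n) → 𝟎 ⊕ u ≡ u
⊕-identityˡ []       = refl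
⊕-identityˡ (x ∷ xs) = cong (x ∷_) (⊕-identityˡ xs)

⊕-identityʳ : (u : Bits n) → u ⊕ 𝟎 ≡ u
⊕-identityʳ u = trans (⊕-comm u 𝟎) (⊕-identityˡ u)

⊕-cancelʳ : (u v : Bits n) → (u ⊕ v) ⊕ v ≡ u
⊕-cancelʳ u v = begin
  (u ⊕ v) ⊕ v  ≡⟨ ⊕-assoc u v v ⟩
  u ⊕ (v ⊕ v)  ≡⟨ cong (u ⊕_) (⊕-self v) ⟩
  u ⊕ 𝟎        ≡⟨ ⊕-identityʳ u ⟩
  u            ∎
  where open ≡-Reasoning

⊕-middle : (u v w : Bits n) → (u ⊕ v) ⊕ (v ⊕ w) ≡ u ⊕ w
⊕-middle u v w = trans (sym (⊕-assoc (u ⊕ v) v w)) (cong (_⊕ w) (⊕-cancelʳ u v))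

comp-⊕ : (u v : Bits n) → comp u ⊕ v ≡ comp (u ⊕ v)
comp-⊕ []       []       = refl
comp-⊕ (x ∷ xs) (y ∷ ys) = cong₂ _∷_ (sym (not-distribˡ-xor x y)) (comp-⊕ xs ys)

comp-involutive : (u : Bits n) → comp (comp u) ≡ u
comp-involutive []       = refl
comp-involutive (x ∷ xs) = cong₂ _∷_ (not-involutive x) (comp-involutive xs)

flip-⊕ : (i : Fin n) (u v : Bits n) → flip i u ⊕ v ≡ flip i (u ⊕ v)
flip-⊕ zero    (x ∷ xs) (y ∷ ys) = cong (_∷ xs ⊕ ys) (sym (not-distribˡ-xor x y))
flip-⊕ (suc i) (x ∷ xs) (y ∷ ys) = cong ((x xor y) ∷_) (flip-⊕ i xs ys)

⊕-flip : (i : Fin n) (u v : Bits n) → u ⊕ flip i v ≡ flip i (u ⊕ v)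
⊕-flip i u v = trans (⊕-comm u _) (trans (flip-⊕ i v u) (cong (flip i) (⊕-comm v u)))

flip-involutive : (i : Fin n) (u : Bits n) → flip i (flip i u) ≡ u
flip-involutive zero    (x ∷ xs) = cong (_∷ xs) (not-involutive x)
flip-involutive (suc i) (x ∷ xs) = cong (x ∷_) (flip-involutive i xs)

flip-comp : (i : Fin n) (u : Bits n) → flip i (comp u) ≡ comp (flip i u)
flip-comp zero    (x ∷ xs) = refl
flip-comp (suc i) (x ∷ xs) = cong (not x ∷_) (flip-comp i xs)

lookup-ext : {u v : Bits n} → (∀ i → lookup u i ≡ lookup v i) → u ≡ v
lookup-ext {u = u} {v} e =
  trans (sym (tabulate∘lookup u)) (trans (tabulate-cong e) (tabulate∘lookup v))

≈-refl : {u : Bits n} → u ≈ u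
≈-refl = inj₁ refl

≈-sym : {u v : Bits n} → u ≈ v → v ≈ u
≈-sym (inj₁ p) = inj₁ (sym p)
≈-sym (inj₂ p) = inj₂ (trans (sym (comp-involutive _)) (cong comp (sym p)))

≈-trans : {u v w : Bits n} → u ≈ v → v ≈ w → u ≈ w
≈-trans (inj₁ refl) q           = q
≈-trans (inj₂ refl) (inj₁ refl) = inj₂ refl
≈-trans (inj₂ refl) (inj₂ refl) = inj₁ (comp-involutive _)

comp-≈ : (u : Bits n) → comp u ≈ u
comp-≈ u = inj₂ refl

⊕-congˡ-≈ : {u v : Bits n} (w : Bits n) → u ≈ v → u ⊕ w ≈ v ⊕ w
⊕-congˡ-≈ w (inj₁ refl) = inj₁ refl
⊕-congˡ-≈ w (inj₂ refl) = inj₂ (comp-⊕ _ w)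

⊕-cancel-≈ : {u v : Bits n} (w : Bits n) → u ⊕ w ≈ v ⊕ w → u ≈ v
⊕-cancel-≈ {u = u} {v} w p = subst₂ _≈_ (⊕-cancelʳ u w) (⊕-cancelʳ v w) (⊕-congˡ-≈ w p)

_≈?_ : (u v : Bits n) → Dec (u ≈ v)
u ≈? v = (u ≟ v) ⊎-dec (u ≟ comp v)

wt-𝟎 : wt (𝟎 {n}) ≡ 0
wt-𝟎 {zero}  = refl
wt-𝟎 {suc n} = wt-𝟎 {n}

wt-comp : (u : Bits n) → wt (comp u) + wt u ≡ n
wt-comp []           = refl
wt-comp (true ∷ xs)  = trans (+-suc _ _) (cong suc (wt-comp xs))
wt-comp (false ∷ xs) = cong suc (wt-comp xs)

wt-flip-false : (i : Fin n) (u : Bits n) → lookup u i ≡ false → wt (flip i u) ≡ suc (wt u)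
wt-flip-false zero    (false ∷ xs) refl = refl
wt-flip-false (suc i) (x ∷ xs)     e    =
  trans (cong (b2n x +_) (wt-flip-false i xs e)) (+-suc (b2n x) _)

wt-flip-true : (i : Fin n) (u : Bits n) → lookup u i ≡ true → suc (wt (flip i u)) ≡ wt u
wt-flip-true zero    (true ∷ xs) refl = refl
wt-flip-true (suc i) (x ∷ xs)    e    =
  trans (sym (+-suc (b2n x) _)) (cong (b2n x +_) (wt-flip-true i xs e))

par-flip : (i : Fin n) (u : Bits n) → par (flip i u) ≡ not (par u)
par-flip i u with lookup u i in e
... | false = cong odd (wt-flip-false i u e)
... | true  = trans (sym (not-involutive _)) (cong (not ∘ odd) (wt-flip-true i u e))

flip₂ : Fin n → Fin n → Bits n → Bits n
flip₂ i j u = flip i (flip j u)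

n≢2+n : ∀ {m} → m ≢ suc (suc m)
n≢2+n = ℕ.<⇒≢ (s≤s (ℕ.n≤1+n _))

module _ {i j : Fin n} (i≢j : i ≢ j) (u : Bits n) where
  private
    lookup-flip : lookup (flip j u) i ≡ lookup u i
    lookup-flip = lookup∘updateAt′ i j i≢j u

  -- One flip adds a one and the other removes one.
  wt-flip₂-≢ : lookup u i ≢ lookup u j → wt (flip₂ i j u) ≡ wt u
  wt-flip₂-≢ ne with lookup u i in p | lookup u j in q
  ... | false | false = contradiction refl ne
  ... | true  | true  = contradiction refl ne
  ... | false | true  = trans (wt-flip-false i (flip j u) (trans lookup-flip p)) (wt-flip-true j u q)
  ... | true  | false =
    suc-injective (trans (wt-flip-true i (flip j u) (trans lookup-flip p)) (wt-flip-false j u q))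

  -- Both flips move the weight in the same direction, so it changes by two.
  wt-flip₂-≡ : lookup u i ≡ lookup u j → wt (flip₂ i j u) ≢ wt u
  wt-flip₂-≡ eq same with lookup u i in p | lookup u j in q
  wt-flip₂-≡ refl same | false | false =
    n≢2+n (trans (sym same) (trans (wt-flip-false i (flip j u) (trans lookup-flip p))
      (cong suc (wt-flip-false j u q))))
  wt-flip₂-≡ refl same | true | true =
    n≢2+n (trans same (trans (sym (wt-flip-true j u q))
      (cong suc (sym (wt-flip-true i (flip j u) (trans lookup-flip p))))))

odd-+ : ∀ m p → odd (m + p) ≡ odd m xor odd p
odd-+ zero    p = refl
odd-+ (suc m) p = trans (cong not (odd-+ m p)) (not-distribˡ-xor (odd m) (odd p))

par-⊕ : (u v : Bits n) → par (u ⊕ v) ≡ par u xor par v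
par-⊕ []           []           = refl
par-⊕ (false ∷ xs) (false ∷ ys) = par-⊕ xs ys
par-⊕ (true ∷ xs)  (false ∷ ys) = trans (cong not (par-⊕ xs ys)) (not-distribˡ-xor (par xs) _)
par-⊕ (false ∷ xs) (true ∷ ys)  = trans (cong not (par-⊕ xs ys)) (not-distribʳ-xor (par xs) _)
par-⊕ (true ∷ xs)  (true ∷ ys)  = trans (par-⊕ xs ys) (sym (trans (sym (not-distribˡ-xor (par xs) _))
  (trans (cong not (sym (not-distribʳ-xor (par xs) (par ys)))) (not-involutive _))))

⊕-comp : (u v : Bits n) → u ⊕ comp v ≡ comp (u ⊕ v)
⊕-comp u v = trans (⊕-comm u _) (trans (comp-⊕ v u) (cong comp (⊕-comm v u)))

flip₂-⊕ : (i j : Fin n) (u v : Bits n) → flip₂ i j u ⊕ v ≡ flip₂ i j (u ⊕ v)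
flip₂-⊕ i j u v = trans (flip-⊕ i _ v) (cong (flip i) (flip-⊕ j u v))

n+n-injective : ∀ {m p} → m + m ≡ p + p → m ≡ p
n+n-injective {m} {p} e =
  trans (ℕ.n≡⌊n+n/2⌋ m) (trans (cong Data.Nat.⌊_/2⌋ e) (sym (ℕ.n≡⌊n+n/2⌋ p)))

wt-comp-half : ∀ {k} → n ≡ k + k → (u : Bits n) → wt u ≡ k → wt (comp u) ≡ k
wt-comp-half n≡2k u refl = ℕ.+-cancelʳ-≡ (wt u) _ _ (trans (wt-comp u) n≡2k)

odd-double : ∀ k → odd (k + k) ≡ false
odd-double k = trans (odd-+ k k) (xor-same (odd k))

par-comp : ∀ {k} → n ≡ k + k → (u : Bits n) → par (comp u) ≡ par u
par-comp {k = k} n≡2k u = xor≡false⇒≡ _ _ (begin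
  par (comp u) xor par u   ≡⟨ sym (odd-+ (wt (comp u)) (wt u)) ⟩
  odd (wt (comp u) + wt u) ≡⟨ cong odd (trans (wt-comp u) n≡2k) ⟩
  odd (k + k)              ≡⟨ odd-double k ⟩
  false                    ∎)
  where
  open ≡-Reasoning
  xor≡false⇒≡ : ∀ x y → x xor y ≡ false → x ≡ y
  xor≡false⇒≡ false false _ = refl
  xor≡false⇒≡ true  true  _ = refl

≈-par : ∀ {k} → n ≡ k + k → {u v : Bits n} → u ≈ v → par u ≡ par v
≈-par         n≡2k         (inj₁ refl) = refl
≈-par {k = k} n≡2k {v = v} (inj₂ refl) = par-comp {k = k} n≡2k v

-- Balanced and separating vectors

-- Alternates along each of the two classes of positions {i | a i = false} and
-- {i | a i = true}, starting with p on the first and q on the second.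
half : Bool → Bool → Bits n → Bits n
half p q []          = []
half p q (false ∷ a) = p ∷ half (not p) q a
half p q (true ∷ a)  = q ∷ half p (not q) a

half-swap : ∀ p q (a : Bits n) → half p q a ≡ half q p (comp a)
half-swap p q []          = refl
half-swap p q (false ∷ a) = cong (p ∷_) (half-swap (not p) q a)
half-swap p q (true ∷ a)  = cong (q ∷_) (half-swap p (not q) a)

half-not : ∀ p q (a : Bits n) → half (not p) (not q) a ≡ comp (half p q a)
half-not p q []          = refl
half-not p q (false ∷ a) = cong (not p ∷_) (half-not (not p) q a)
half-not p q (true ∷ a)  = cong (not q ∷_) (half-not p (not q) a)

half-⊕ : ∀ p q (a : Bits n) → half p q a ⊕ a ≡ half p (not q) a
half-⊕ p q []          = refl
half-⊕ p q (false ∷ a) = cong₂ _∷_ (xor-identityʳ p) (half-⊕ (not p) q a)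
half-⊕ p q (true ∷ a)  = cong₂ _∷_ (xor-comm q true) (half-⊕ p (not q) a)

-- The second class has `wt a` positions; an alternating string of odd length has one more `true` if
-- it starts with `true`, and one of even length is balanced.
wt-half : ∀ p (a : Bits n) → wt (half p true a) ≡ b2n (par a) + wt (half p false a)
wt-half p []          = refl
wt-half p (false ∷ a) = begin
  b2n p + wt (half (not p) true a)                    ≡⟨ cong (b2n p +_) (wt-half (not p) a) ⟩
  b2n p + (b2n (par a) + wt (half (not p) false a))   ≡⟨ sym (+-assoc (b2n p) _ _) ⟩
  b2n p + b2n (par a) + wt (half (not p) false a)     ≡⟨ cong (_+ wt (half (not p) false a)) (+-comm (b2n p) _) ⟩
  b2n (par a) + b2n p + wt (half (not p) false a)     ≡⟨ +-assoc (b2n (par a)) _ _ ⟩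
  b2n (par a) + (b2n p + wt (half (not p) false a))   ∎
  where open ≡-Reasoning
wt-half p (true ∷ a) with par a | wt-half p a
... | false | e = cong suc (sym e)
... | true  | e = sym e

wt-half-notʳ : ∀ p q (a : Bits n) → par a ≡ false → wt (half p (not q) a) ≡ wt (half p q a)
wt-half-notʳ p q a e with par a | wt-half p a
wt-half-notʳ p true  a refl | false | h = sym h
wt-half-notʳ p false a refl | false | h = h

module _ {k} (n≡2k : n ≡ k + k) where

  -- When both classes have even size, either starting bit can be reversed without changing the
  -- weight. Reversing both gives the complement, so the string and its complement weigh the same.
  wt-half≡k : ∀ p q (a : Bits n) → par a ≡ false → wt (half p q a) ≡ k
  wt-half≡k p q a even = n+n-injective (begin
    wt h + wt h                        ≡⟨ cong (_+ wt h) (sym (wt-half-notʳ p q a even)) ⟩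
    wt (half p (not q) a) + wt h       ≡⟨ cong (λ x → wt x + wt h) (half-swap p (not q) a) ⟩
    wt (half (not q) p (comp a)) + wt h
      ≡⟨ cong (_+ wt h) (sym (wt-half-notʳ (not q) p (comp a) (trans (par-comp {k = k} n≡2k a) even))) ⟩
    wt (half (not q) (not p) (comp a)) + wt h
      ≡⟨ cong (λ x → wt x + wt h) (sym (half-swap (not p) (not q) a)) ⟩
    wt (half (not p) (not q) a) + wt h ≡⟨ cong (λ x → wt x + wt h) (half-not p q a) ⟩
    wt (comp h) + wt h                 ≡⟨ wt-comp h ⟩
    n                                  ≡⟨ n≡2k ⟩
    k + k                              ∎)
    where
    open ≡-Reasoning
    h = half p q a

  balanced : (a : Bits n) → par a ≡ false → ∃ λ y → wt y ≡ k × wt (y ⊕ a) ≡ k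
  balanced a even = half true true a , wt-half≡k true true a even
    , trans (cong wt (half-⊕ true true a)) (wt-half≡k true false a even)

  balanced⇒even : (y a : Bits n) → wt y ≡ k → wt (y ⊕ a) ≡ k → par a ≡ false
  balanced⇒even y a p q = xor-fix (par y) (par a)
    (trans (sym (par-⊕ y a)) (cong odd (trans q (sym p))))
    where
    xor-fix : ∀ x z → x xor z ≡ x → z ≡ false
    xor-fix false false _ = refl
    xor-fix true  false _ = refl

wt-⊕-below : (y a : Bits n) → (∀ l → lookup a l ≡ true → lookup y l ≡ true) →
  wt (y ⊕ a) + wt a ≡ wt y
wt-⊕-below []           []          h = refl
wt-⊕-below (true ∷ y)   (true ∷ a)  h = trans (+-suc _ _) (cong suc (wt-⊕-below y a (h ∘ suc)))
wt-⊕-below (true ∷ y)   (false ∷ a) h = cong suc (wt-⊕-below y a (h ∘ suc))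
wt-⊕-below (false ∷ y)  (false ∷ a) h = wt-⊕-below y a (h ∘ suc)
wt-⊕-below (false ∷ y)  (true ∷ a)  h with () ← h zero refl

wt≡0⇒false : (a : Bits n) → wt a ≡ 0 → ∀ i → lookup a i ≡ false
wt≡0⇒false (false ∷ a) e zero    = refl
wt≡0⇒false (false ∷ a) e (suc i) = wt≡0⇒false a e i

-- If the ones of `a` were among those of `y`, adding `a` would lower the weight by `wt a`, which is
-- positive because of position `i`.
below-unbalanced : (y a : Bits n) → wt y ≡ wt (y ⊕ a) → ∀ i → lookup a i ≡ true →
  ¬ (∀ l → lookup a l ≡ true → lookup y l ≡ true)
below-unbalanced y a e i ai below =
  true≢false (trans (sym ai) (wt≡0⇒false a wt-a≡0 i))
  where
  true≢false : true ≢ false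
  true≢false ()
  wt-a≡0 : wt a ≡ 0
  wt-a≡0 = ℕ.+-cancelˡ-≡ (wt (y ⊕ a)) _ _
    (trans (wt-⊕-below y a below) (trans e (sym (ℕ.+-identityʳ _))))

not-eq : ∀ {x y z : Bool} → x ≢ y → z ≢ y → x ≡ z
not-eq p q = trans (¬-not p) (sym (¬-not q))

xor-not : ∀ {x y x' y' : Bool} → x ≢ x' → y ≢ y' → x xor y ≡ x' xor y'
xor-not {x' = x'} {y'} p q = trans (cong₂ _xor_ (¬-not p) (¬-not q)) (xor-annihilates-not x' y')

xor-cancelʳ : ∀ x x' z → x xor z ≡ x' xor z → x ≡ x'
xor-cancelʳ false false z     e = refl
xor-cancelʳ true  true  z     e = refl
xor-cancelʳ false true  false ()
xor-cancelʳ false true  true  ()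
xor-cancelʳ true  false false ()
xor-cancelʳ true  false true  ()

-- On a class on which y is balanced with respect to both 𝟎 and a, it cannot be constant.
nonconstant : ∀ {k} → n ≡ k + k → (y a : Bits n) → wt y ≡ k → wt (y ⊕ a) ≡ k →
  ∀ i → ∃ λ l → lookup a l ≡ lookup a i × lookup y l ≢ lookup y i
nonconstant {n} {k} n≡2k y a p q i
  with Fin.any? (λ l → (lookup a l Data.Bool.≟ lookup a i) ×-dec ¬? (lookup y l Data.Bool.≟ lookup y i))
... | yes r = r
... | no ¬r = ⊥-elim (absurd (lookup a i) refl)
  where
  constant : ∀ l → lookup a l ≡ lookup a i → lookup y l ≡ lookup y i
  constant l e = decidable-stable (_ Data.Bool.≟ _) λ ne → ¬r (l , e , ne)

  -- If `y` is constantly `true` on the ones of `a`, adding `a` makes it lighter; if constantly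
  -- `false`, the same applies to `y ⊕ a`, from which adding `a` leads back to `y`. The zeros of `a`
  -- are treated as the ones of `comp a`.
  on-true : (a : Bits n) → wt (y ⊕ a) ≡ k → lookup a i ≡ true →
    ¬ (∀ l → lookup a l ≡ true → lookup y l ≡ lookup y i)
  on-true a q ai c with lookup y i
  ... | true  = below-unbalanced y a (trans p (sym q)) i ai c
  ... | false = below-unbalanced (y ⊕ a) a
    (trans q (trans (sym p) (cong wt (sym (⊕-cancelʳ y a))))) i ai
    λ l al → trans (lookup-zipWith _xor_ l y a) (cong₂ _xor_ (c l al) al)

  absurd : ∀ b → lookup a i ≢ b
  absurd true  ai = on-true a q ai λ l al → constant l (trans al (sym ai))
  absurd false ai = on-true (comp a)
    (trans (cong wt (⊕-comp y a)) (wt-comp-half n≡2k (y ⊕ a) q))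
    (trans (lookup-map i not a) (cong not ai))
    λ l al → constant l (trans (trans (sym (not-involutive _))
      (cong not (trans (sym (lookup-map l not a)) al))) (sym ai))

constant⇒≈𝟎 : (u : Bits n) (i : Fin n) → (∀ l → lookup u l ≡ lookup u i) → u ≈ 𝟎
constant⇒≈𝟎 {n} u i c with lookup u i
... | false = inj₁ (lookup-ext λ l → trans (c l) (sym (lookup-𝟎 l)))
  where
  lookup-𝟎 : (l : Fin n) → lookup 𝟎 l ≡ false
  lookup-𝟎 l = lookup-replicate l false
... | true  = inj₂ (lookup-ext λ l → trans (c l) (sym (trans (lookup-map l not 𝟎)
    (cong not (lookup-replicate l false)))))

-- Without such a pair each bit of `b` is a function of the corresponding bit of `a`. A constant
-- function gives `b ≈ 𝟎`; the identity and negation give `b ≈ a`.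
split-pair : (a b : Bits n) → ¬ (b ≈ 𝟎) → ¬ (b ≈ a) →
  ∃ λ i → ∃ λ j → lookup a i ≡ lookup a j × lookup b i ≢ lookup b j
split-pair []        []        b≉𝟎 b≉a = contradiction (inj₁ refl) b≉𝟎
split-pair a@(_ ∷ _) b@(_ ∷ _) b≉𝟎 b≉a
  with Fin.any? (λ i → Fin.any? λ j →
         (lookup a i Data.Bool.≟ lookup a j) ×-dec ¬? (lookup b i Data.Bool.≟ lookup b j))
... | yes r = r
... | no ¬r with Fin.any? (λ j → ¬? (lookup b j Data.Bool.≟ lookup b zero))
...   | no ¬s =
  contradiction (constant⇒≈𝟎 b zero λ l → decidable-stable (_ Data.Bool.≟ _) λ ne → ¬s (l , ne)) b≉𝟎
...   | yes (j , bj≢b₀) = contradiction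
  (⊕-cancel-≈ a (subst (b ⊕ a ≈_) (sym (⊕-self a)) (constant⇒≈𝟎 (b ⊕ a) zero λ l →
    trans (lookup-zipWith _xor_ l b a) (trans (same l) (sym (lookup-zipWith _xor_ zero b a)))))) b≉a
  where
  respects : ∀ i j → lookup a i ≡ lookup a j → lookup b i ≡ lookup b j
  respects i j e = decidable-stable (_ Data.Bool.≟ _) λ ne → ¬r (i , j , e , ne)
  same : ∀ l → lookup b l xor lookup a l ≡ lookup b zero xor lookup a zero
  same l with lookup a l Data.Bool.≟ lookup a zero
  ... | yes e = cong₂ _xor_ (respects l zero e) e
  ... | no ne = xor-not
    (λ e → bj≢b₀ (trans (sym (respects l j (not-eq ne (aj≢a₀)))) e)) ne
    where
    aj≢a₀ : lookup a j ≢ lookup a zero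
    aj≢a₀ e = bj≢b₀ (respects j zero e)

-- If y is a solution for a which happens to be balanced with respect to b too, then
-- swapping two positions on which a agrees but both b and y differ destroys only the latter.
separate : ∀ {k} → n ≡ k + k → (a b : Bits n) → par a ≡ false → ¬ (b ≈ 𝟎) → ¬ (b ≈ a) →
  ∃ λ y → wt y ≡ k × wt (y ⊕ a) ≡ k × wt (y ⊕ b) ≢ k
separate {n} {k} n≡2k a b even b≉𝟎 b≉a
  with y , p , q ← balanced n≡2k a even
  with wt (y ⊕ b) Data.Nat.≟ k
... | no ne = y , p , q , ne
... | yes e = y' , trans (wt-flip₂-≢ i≢j y yij) p
  , trans (cong wt (flip₂-⊕ i j y a)) (trans (wt-flip₂-≢ i≢j (y ⊕ a) (ya-differ)) q)
  , λ e' → wt-flip₂-≡ i≢j (y ⊕ b) yb-agree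
      (trans (cong wt (sym (flip₂-⊕ i j y b))) (trans e' (sym e)))
  where
  Good : Fin n → Fin n → Set
  Good i j = lookup a i ≡ lookup a j × lookup b i ≢ lookup b j × lookup y i ≢ lookup y j
  good : ∃ λ i → ∃ λ j → Good i j
  good with split-pair a b b≉𝟎 b≉a
  ... | i , j , aij , bij with lookup y i Data.Bool.≟ lookup y j
  -- If `y` agrees at `i` and `j`, take `l` in the same class of `a` with a different value of `y`.
  -- As `b` differs at `i` and `j`, it differs at `l` and one of them.
  ... | no yij = i , j , aij , bij , yij
  ... | yes yij with nonconstant n≡2k y a p q i
  ... | l , ali , yli with lookup b l Data.Bool.≟ lookup b i
  ... | no bli  = l , i , ali , bli , yli
  ... | yes bli = l , j , trans ali aij , (λ e → bij (trans (sym bli) e)) , λ e → yli (trans e (sym yij))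
  i = proj₁ good
  j = proj₁ (proj₂ good)
  aij = proj₁ (proj₂ (proj₂ good))
  bij = proj₁ (proj₂ (proj₂ (proj₂ good)))
  yij = proj₂ (proj₂ (proj₂ (proj₂ good)))
  y' = flip₂ i j y
  i≢j : i ≢ j
  i≢j e = yij (cong (lookup y) e)
  ya-differ : lookup (y ⊕ a) i ≢ lookup (y ⊕ a) j
  ya-differ e = yij (xor-cancelʳ _ _ (lookup a i) (trans (sym (lookup-zipWith _xor_ i y a))
    (trans e (trans (lookup-zipWith _xor_ j y a) (cong (lookup y j xor_) (sym aij))))))
  yb-agree : lookup (y ⊕ b) i ≡ lookup (y ⊕ b) j
  yb-agree = trans (lookup-zipWith _xor_ i y b) (trans (xor-not yij bij) (sym (lookup-zipWith _xor_ j y b)))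

par-𝟎 : par (𝟎 {n}) ≡ false
par-𝟎 {n} = cong odd (wt-𝟎 {n})

comp≢ : (u : Bits (suc n)) → comp u ≢ u
comp≢ (true ∷ u)  ()
comp≢ (false ∷ u) ()

-- Automorphisms

-- `Ω k` is `Hamming (2 * k) k`; a separate length allows the form `2 + N`, which exposes the first
-- two coordinates.
Hamming : ℕ → ℕ → Graph
Hamming n k = record { V = Bits n ; Adj = λ u v → hamming u v ≡ k }

spoke : ∀ {N} → Fin N → Bits (2 + N) → Bits (2 + N)
spoke j = flip₂ zero (suc (suc j))

-- Comparison with coordinate 0 determines all coordinates from 2 on; coordinate 1 is then what is
-- left of the weight.
spoke-lookups⇒≡ : ∀ {N} (y z : Bits (2 + N)) → wt y ≡ wt z → lookup y zero ≡ lookup z zero →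
  (∀ j → lookup y zero ≡ lookup y (suc (suc j)) → lookup z zero ≡ lookup z (suc (suc j))) →
  (∀ j → lookup z zero ≡ lookup z (suc (suc j)) → lookup y zero ≡ lookup y (suc (suc j))) →
  y ≡ z
spoke-lookups⇒≡ (x ∷ y₁ ∷ ys) (.x ∷ z₁ ∷ zs) w refl f g = cong (x ∷_) (cong₂ _∷_ y₁≡z₁ ys≡zs)
  where
  pointwise : ∀ s t → (x ≡ s → x ≡ t) → (x ≡ t → x ≡ s) → s ≡ t
  pointwise s t f g with x Data.Bool.≟ s | x Data.Bool.≟ t
  ... | yes a | _     = trans (sym a) (f a)
  ... | no  a | yes b = contradiction (g b) a
  ... | no  a | no  b = not-eq (a ∘ sym) (b ∘ sym)

  ys≡zs : ys ≡ zs
  ys≡zs = lookup-ext λ j → pointwise (lookup ys j) (lookup zs j) (f j) (g j)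

  b2n-injective : ∀ s t → b2n s ≡ b2n t → s ≡ t
  b2n-injective false false _ = refl
  b2n-injective true  true  _ = refl

  y₁≡z₁ : y₁ ≡ z₁
  y₁≡z₁ = b2n-injective y₁ z₁ (ℕ.+-cancelʳ-≡ (wt zs) _ _
    (trans (cong (λ l → b2n y₁ + wt l) (sym ys≡zs)) (ℕ.+-cancelˡ-≡ (b2n x) _ _ w)))

lookup-comp-injective : (y : Bits n) (i j : Fin n) →
  lookup (comp y) i ≡ lookup (comp y) j → lookup y i ≡ lookup y j
lookup-comp-injective y i j e =
  not-injective (trans (sym (lookup-map i not y)) (trans e (lookup-map j not y)))

lookup-comp-cong : (y : Bits n) (i j : Fin n) →
  lookup y i ≡ lookup y j → lookup (comp y) i ≡ lookup (comp y) j
lookup-comp-cong y i j e =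
  trans (lookup-map i not y) (trans (cong not e) (sym (lookup-map j not y)))

spoke-lookups⇒≈ : ∀ {N k} → 2 + N ≡ k + k → (y z : Bits (2 + N)) → wt y ≡ k → wt z ≡ k →
  (∀ j → lookup y zero ≡ lookup y (suc (suc j)) → lookup z zero ≡ lookup z (suc (suc j))) →
  (∀ j → lookup z zero ≡ lookup z (suc (suc j)) → lookup y zero ≡ lookup y (suc (suc j))) →
  y ≈ z
spoke-lookups⇒≈ n≡2k y z p q f g with lookup y zero Data.Bool.≟ lookup z zero
... | yes e = inj₁ (spoke-lookups⇒≡ y z (trans p (sym q)) e f g)
... | no ne = inj₂ (spoke-lookups⇒≡ y (comp z) (trans p (sym (wt-comp-half n≡2k z q)))
  (trans (¬-not ne) (sym (lookup-map zero not z)))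
  (λ j e → lookup-comp-cong z zero (suc (suc j)) (f j e))
  (λ j e → g j (lookup-comp-injective z zero (suc (suc j)) e)))

-- Adjacency, twins and parity

module Orthogonality {n : ℕ} (k : ℕ) (n≡2k : n ≡ k + k) where

  infix 4 _~_

  -- A record rather than a bare equation, so that `u` and `v` can be inferred from a proof.
  record _~_ (u v : Bits n) : Set where
    constructor orthogonal
    field wt≡k : wt (u ⊕ v) ≡ k

  open _~_

  -- Even distance. The lemmas `common-neighbour⇒even` and `even⇒common-neighbour` express it in
  -- terms of the graph, which makes it accessible to automorphisms.
  record Even (v c : Bits n) : Set where
    constructor even
    field par≡false : par (v ⊕ c) ≡ false

  open Even

  ~-sym : ∀ {u v} → u ~ v → v ~ u
  ~-sym {u} {v} (orthogonal p) = orthogonal (trans (cong wt (⊕-comm v u)) p)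

  wt-≈ : {u v : Bits n} → u ≈ v → wt u ≡ k → wt v ≡ k
  wt-≈ {u} {v} p q with ≈-sym p
  ... | inj₁ refl = q
  ... | inj₂ refl = wt-comp-half n≡2k u q

  ~-≈ˡ : ∀ {u v z} → u ≈ v → u ~ z → v ~ z
  ~-≈ˡ {z = z} p (orthogonal q) = orthogonal (wt-≈ (⊕-congˡ-≈ z p) q)

  ~-≈ʳ : ∀ {u v z} → u ≈ v → z ~ u → z ~ v
  ~-≈ʳ p q = ~-sym (~-≈ˡ p (~-sym q))

  even? : ∀ v c → Dec (Even v c)
  even? v c = map′ even par≡false (par (v ⊕ c) Data.Bool.≟ false)

  even-≈ : ∀ {u v c} → u ≈ v → Even u c → Even v c
  even-≈ {c = c} p (even e) = even (trans (sym (≈-par {k = k} n≡2k (⊕-congˡ-≈ c p))) e)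

  par-middle : (u v w : Bits n) → par (u ⊕ v) xor par (v ⊕ w) ≡ par (u ⊕ w)
  par-middle u v w = trans (sym (par-⊕ (u ⊕ v) (v ⊕ w))) (cong par (⊕-middle u v w))

  odd-neighbour : ∀ {x v c} → odd k ≡ true → ¬ Even v c → x ~ v → Even x c
  odd-neighbour {x} {v} {c} odd-k ne (orthogonal p) = even
    (trans (sym (par-middle x v c))
      (cong₂ _xor_ (trans (cong odd p) odd-k) (¬-not (ne ∘ even))))

  par-⊕-flip : (i : Fin n) (v c : Bits n) → par (v ⊕ flip i c) ≡ not (par (v ⊕ c))
  par-⊕-flip i v c = trans (cong par (⊕-flip i v c)) (par-flip i (v ⊕ c))

  odd⇒even-flip : ∀ {v c} i → ¬ Even v c → Even v (flip i c)
  odd⇒even-flip {v} {c} i ne =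
    even (trans (par-⊕-flip i v c) (cong not (¬-not (ne ∘ even))))

  even-flip⇒odd : ∀ {v c} i → Even v (flip i c) → ¬ Even v c
  even-flip⇒odd {v} {c} i (even p) (even q)
    with () ← trans (sym p) (trans (par-⊕-flip i v c) (cong not q))

  common-neighbour⇒even : ∀ {x c v} → x ~ c → x ~ v → Even v c
  common-neighbour⇒even {x} {c} {v} (orthogonal p) (orthogonal q) =
    even (balanced⇒even n≡2k (x ⊕ c) (v ⊕ c) p
      (trans (cong wt (trans (cong (x ⊕ c ⊕_) (⊕-comm v c)) (⊕-middle x c v))) q))

  even⇒common-neighbour : ∀ c v → Even v c → ∃ λ x → x ~ c × x ~ v
  even⇒common-neighbour c v (even e) with y , p , q ← balanced n≡2k (v ⊕ c) e =
    y ⊕ c , orthogonal (trans (cong wt (⊕-cancelʳ y c)) p)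
    , orthogonal (trans (cong wt (trans (⊕-assoc y c v) (cong (y ⊕_) (⊕-comm c v)))) q)

  -- After translation by `c`, `separate` would otherwise yield a common neighbour of `c` and `v`
  -- that is not adjacent to `w`.
  determined : ∀ c v w → Even v c → (∀ x → x ~ c → x ~ v → x ~ w) → w ≈ c ⊎ w ≈ v
  determined c v w (even e) h with w ≈? c | w ≈? v
  ... | yes p | _     = inj₁ p
  ... | no  _ | yes q = inj₂ q
  ... | no  p | no  q
    with y , a , b , ne ← separate n≡2k (v ⊕ c) (w ⊕ c) e
           (λ r → p (⊕-cancel-≈ c (subst (w ⊕ c ≈_) (sym (⊕-self c)) r)))
           (λ r → q (⊕-cancel-≈ c r)) =
    contradiction (trans (cong wt (shift w)) (wt≡k (h (y ⊕ c)
      (orthogonal (trans (cong wt (⊕-cancelʳ y c)) a))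
      (orthogonal (trans (cong wt (sym (shift v))) b))))) ne
    where
    shift : ∀ u → y ⊕ (u ⊕ c) ≡ y ⊕ c ⊕ u
    shift u = trans (cong (y ⊕_) (⊕-comm u c)) (sym (⊕-assoc y c u))

  even-self : ∀ v → Even v v
  even-self v = even (trans (cong par (⊕-self v)) (par-𝟎 {n}))

  neighbours⊆⇒≈ : ∀ v w → (∀ x → x ~ v → x ~ w) → w ≈ v
  neighbours⊆⇒≈ v w h with determined v v w (even-self v) (λ x p _ → h x p)
  ... | inj₁ p = p
  ... | inj₂ p = p

  module Automorphism (σ : Bits n ↔ Bits n) (auto : IsAutomorphism (Hamming n k) σ) where
    open Inverse σ using (to; from; strictlyInverseˡ; strictlyInverseʳ)

    to-~ : ∀ {u v} → u ~ v → to u ~ to v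
    to-~ {u} {v} (orthogonal p) = orthogonal
      (trans (sym (hamming-wt (to u) (to v))) (proj₁ (auto u v) (trans (hamming-wt u v) p)))

    to-~⁻ : ∀ {u v} → to u ~ to v → u ~ v
    to-~⁻ {u} {v} (orthogonal p) = orthogonal
      (trans (sym (hamming-wt u v)) (proj₂ (auto u v) (trans (hamming-wt (to u) (to v)) p)))

    to-injective : ∀ {u v} → to u ≡ to v → u ≡ v
    to-injective {u} {v} e =
      trans (sym (strictlyInverseʳ u)) (trans (cong from e) (strictlyInverseʳ v))

    to-≈ : ∀ {u v} → u ≈ v → to u ≈ to v
    to-≈ {u} {v} p = neighbours⊆⇒≈ (to v) (to u) λ x q → subst (_~ to u) (strictlyInverseˡ x)
      (to-~ (~-≈ʳ (≈-sym p) (to-~⁻ (subst (_~ to v) (sym (strictlyInverseˡ x)) q))))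

    to-≈⁻ : ∀ {u v} → to u ≈ to v → u ≈ v
    to-≈⁻ {u} {v} p = neighbours⊆⇒≈ v u λ x q → to-~⁻ (~-≈ʳ (≈-sym p) (to-~ q))

    -- Only the twin class is fixed; `v` itself may go to `comp v`.
    Fixed : Bits n → Set
    Fixed v = to v ≈ v

    to-even : ∀ {c v} → Fixed c → Even v c → Even (to v) c
    to-even {c} {v} fc e with x , p , q ← even⇒common-neighbour c v e =
      common-neighbour⇒even (~-≈ʳ fc (to-~ p)) (to-~ q)

    to-even⁻ : ∀ {c v} → Fixed c → Even (to v) c → Even v c
    to-even⁻ {c} {v} fc e with x , p , q ← even⇒common-neighbour c (to v) e =
      common-neighbour⇒even
        (to-~⁻ (subst (_~ to c) (sym (strictlyInverseˡ x)) (~-≈ʳ (≈-sym fc) p)))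
        (to-~⁻ (subst (_~ to v) (sym (strictlyInverseˡ x)) q))

    -- Common neighbours of `c` and `v` keep their classes, so they are adjacent to `to v` as well
    -- and `determined` applies.
    even-fixed : ∀ {c} → Fixed c → (∀ x → x ~ c → Fixed x) → ∀ v → Even v c → Fixed v
    even-fixed {c} fc fix v e with determined c v (to v) e (λ x p q → ~-≈ˡ (fix x p) (to-~ q))
    ... | inj₂ p = p
    -- Here `to v ≈ c ≈ to c`, so already `v ≈ c`.
    ... | inj₁ p = ≈-trans p (≈-sym (to-≈⁻ (≈-trans p (≈-sym fc))))

-- Spokes around a centre

⊕-flip₂ : (i j : Fin n) (u v : Bits n) → u ⊕ flip₂ i j v ≡ flip₂ i j (u ⊕ v)
⊕-flip₂ i j u v = trans (⊕-flip i u _) (cong (flip i) (⊕-flip j u v))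

module Spokes {N : ℕ} (k : ℕ) (n≡2k : 2 + N ≡ k + k) where
  open Orthogonality k n≡2k public
  open _~_
  open Even

  ~-spoke : ∀ {x c} j → x ~ c → lookup (x ⊕ c) zero ≢ lookup (x ⊕ c) (suc (suc j)) →
    x ~ spoke j c
  ~-spoke {x} {c} j (orthogonal p) ne = orthogonal
    (trans (cong wt (⊕-flip₂ zero (suc (suc j)) x c)) (trans (wt-flip₂-≢ (λ ()) (x ⊕ c) ne) p))

  ~-spoke⁻ : ∀ {x c} j → x ~ c → x ~ spoke j c →
    lookup (x ⊕ c) zero ≢ lookup (x ⊕ c) (suc (suc j))
  ~-spoke⁻ {x} {c} j (orthogonal p) (orthogonal q) e = wt-flip₂-≡ (λ ()) (x ⊕ c) e
    (trans (cong wt (sym (⊕-flip₂ zero (suc (suc j)) x c))) (trans q (sym p)))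

  spokes⇒≈ : ∀ {c x z} → x ~ c → z ~ c → (∀ j → x ~ spoke j c → z ~ spoke j c) →
    (∀ j → z ~ spoke j c → x ~ spoke j c) → x ≈ z
  spokes⇒≈ {c} {x} {z} p q f g = ⊕-cancel-≈ c
    -- Adjacency to a spoke means that two bits disagree, whereas agreement is asked for here; hence
    -- the two implications change places.
    (spoke-lookups⇒≈ n≡2k (x ⊕ c) (z ⊕ c) (wt≡k p) (wt≡k q) (transfer q p g) (transfer p q f))
    where
    transfer : ∀ {x z} → x ~ c → z ~ c → (∀ j → x ~ spoke j c → z ~ spoke j c) → ∀ j →
      lookup (z ⊕ c) zero ≡ lookup (z ⊕ c) (suc (suc j)) →
      lookup (x ⊕ c) zero ≡ lookup (x ⊕ c) (suc (suc j))
    transfer p q f j e = decidable-stable (_ Data.Bool.≟ _)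
      λ ne → ~-spoke⁻ j q (f j (~-spoke j p ne)) e

  spoke-even : ∀ c j → Even (spoke j c) c
  spoke-even c j = even (begin
    par (spoke j c ⊕ c)                ≡⟨ cong par (flip₂-⊕ zero (suc (suc j)) c c) ⟩
    par (spoke j (c ⊕ c))              ≡⟨ par-flip zero (flip (suc (suc j)) (c ⊕ c)) ⟩
    not (par (flip (suc (suc j)) (c ⊕ c))) ≡⟨ cong not (par-flip (suc (suc j)) (c ⊕ c)) ⟩
    not (not (par (c ⊕ c)))            ≡⟨ not-involutive _ ⟩
    par (c ⊕ c)                        ≡⟨ par≡false (even-self c) ⟩
    false                              ∎)
    where open ≡-Reasoning

  module SpokeAutomorphism (σ : Bits (2 + N) ↔ Bits (2 + N))
    (auto : IsAutomorphism (Hamming (2 + N) k) σ) where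
    open Automorphism σ auto public

    neighbours-fixed : ∀ {c} → Fixed c → (∀ j → Fixed (spoke j c)) → ∀ x → x ~ c → Fixed x
    neighbours-fixed fc fs x p = spokes⇒≈ (~-≈ʳ fc (to-~ p)) p
      (λ j q → to-~⁻ (~-≈ʳ (≈-sym (fs j)) q))
      (λ j q → ~-≈ʳ (fs j) (to-~ q))

    component-fixed : ∀ {c} → Fixed c → (∀ j → Fixed (spoke j c)) → ∀ v → Even v c → Fixed v
    component-fixed fc fs = even-fixed fc (neighbours-fixed fc fs)

-- Labellings

triangular : ℕ → ℕ
triangular zero    = 0
triangular (suc m) = m + triangular m

triangular≡C : ∀ m → triangular m ≡ m C 2
triangular≡C zero    = refl
triangular≡C (suc m) = begin
  m + triangular m  ≡⟨ cong₂ _+_ (sym (nC1≡n m)) (triangular≡C m) ⟩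
  m C 1 + m C 2     ≡⟨ nCk+nC[k+1]≡[n+1]C[k+1] m 1 ⟩
  suc m C 2         ∎
  where open ≡-Reasoning

-- Enumerates the two-element subsets of `Fin m` as increasing pairs, those containing `zero` first.
pair : ∀ m → Fin (triangular m) → Fin m × Fin m
pair (suc m) i with Fin.splitAt m i
... | inj₁ j = zero , suc j
... | inj₂ j = Data.Product.map suc suc (pair m j)

pair-< : ∀ m i → proj₁ (pair m i) Fin.< proj₂ (pair m i)
pair-< (suc m) i with Fin.splitAt m i
... | inj₁ j = s≤s z≤n
... | inj₂ j = s≤s (pair-< m j)

pair-injective : ∀ m i j → proj₁ (pair m i) ≡ proj₁ (pair m j) →
  proj₂ (pair m i) ≡ proj₂ (pair m j) → i ≡ j
pair-injective (suc m) i j p q with Fin.splitAt m i in ei | Fin.splitAt m j in ej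
... | inj₁ a | inj₁ b = trans (sym (Fin.splitAt⁻¹-↑ˡ ei))
  (trans (cong (Fin._↑ˡ _) (Fin.suc-injective q)) (Fin.splitAt⁻¹-↑ˡ ej))
... | inj₂ a | inj₂ b = trans (sym (Fin.splitAt⁻¹-↑ʳ ei))
  (trans (cong (m Fin.↑ʳ_) (pair-injective m a b (Fin.suc-injective p) (Fin.suc-injective q)))
    (Fin.splitAt⁻¹-↑ʳ ej))

-- The largest element of `Fin (suc T)` is the default for the case that no `P i` holds; as a colour
-- it serves all remaining classes.
first : ∀ {T} {P : Fin T → Set} → (∀ i → Dec (P i)) → Fin (suc T)
first {zero}  P? = zero
first {suc T} P? with P? zero
... | yes _ = zero
... | no  _ = suc (first (P? ∘ suc))

module _ where
  private variable
    T : ℕ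

  first-cong : {P Q : Fin T → Set} (P? : ∀ i → Dec (P i)) (Q? : ∀ i → Dec (Q i)) →
    (∀ i → P i → Q i) → (∀ i → Q i → P i) → first P? ≡ first Q?
  first-cong {zero}  P? Q? f g = refl
  first-cong {suc T} P? Q? f g with P? zero | Q? zero
  ... | yes _ | yes _ = refl
  ... | yes p | no ¬q = contradiction (f zero p) ¬q
  ... | no ¬p | yes q = contradiction (g zero q) ¬p
  ... | no  _ | no  _ = cong suc (first-cong (P? ∘ suc) (Q? ∘ suc) (f ∘ suc) (g ∘ suc))

  first-zero : {P Q : Fin (suc T) → Set} (P? : ∀ i → Dec (P i)) (Q? : ∀ i → Dec (Q i)) →
    first P? ≡ first Q? → P zero → Q zero
  first-zero P? Q? e p with P? zero | Q? zero
  ... | yes _ | yes q = q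
  ... | no ¬p | _     = contradiction p ¬p

  -- The shared result of the two searches is the required index; `P i` excludes the default.
  first-common : {P Q : Fin T → Set} (P? : ∀ i → Dec (P i)) (Q? : ∀ i → Dec (Q i)) →
    first P? ≡ first Q? → ∀ i → P i → ∃ λ j → P j × Q j
  first-common {suc T} P? Q? e i p with P? zero | Q? zero
  ... | yes p₀ | yes q₀ = zero , p₀ , q₀
  first-common {suc T} P? Q? e zero    p | no ¬p | no _ = contradiction p ¬p
  first-common {suc T} P? Q? e (suc i) p | no _  | no _
    with j , pj , qj ← first-common (P? ∘ suc) (Q? ∘ suc) (Fin.suc-injective e) i p =
    suc j , pj , qj

-- The labels of v and comp v are forced to be distinct, so that together they amount to an
-- unordered pair of labels, i.e. to a colour of the twin class {v , comp v}.
module Labelling {n : ℕ} (k m : ℕ) (1+n≡2k : suc n ≡ k + k) {T : ℕ} (T≤ : suc T ≤ m C 2)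
  (Q : Fin T → Bits (suc n) → Set) (Q? : ∀ i v → Dec (Q i v))
  (Q-≈ : ∀ i {u v} → u ≈ v → Q i u → Q i v) where
  open Orthogonality k 1+n≡2k

  colour : Bits (suc n) → Fin (suc T)
  colour v = first (λ i → Q? i v)

  colour-≈ : ∀ {u v} → u ≈ v → colour u ≡ colour v
  colour-≈ p = first-cong _ _ (λ i → Q-≈ i p) (λ i → Q-≈ i (≈-sym p))

  T≤triangular : suc T ≤ triangular m
  T≤triangular = subst (suc T ≤_) (sym (triangular≡C m)) T≤

  low high : Fin (suc T) → Fin m
  low  c = proj₁ (pair m (Fin.inject≤ c T≤triangular))
  high c = proj₂ (pair m (Fin.inject≤ c T≤triangular))

  low<high : ∀ c → low c Fin.< high c
  low<high c = pair-< m _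

  low-high-injective : ∀ c d → low c ≡ low d → high c ≡ high d → c ≡ d
  low-high-injective c d p q = Fin.inject≤-injective _ _ c d (pair-injective m _ _ p q)

  choose : Bool → Fin (suc T) → Fin m
  choose b c = if b then high c else low c

  choose-injective : ∀ a b c d → choose a c ≡ choose b d → choose (not a) c ≡ choose (not b) d → c ≡ d
  choose-injective false false c d p q = low-high-injective c d p q
  choose-injective true  true  c d p q = low-high-injective c d q p
  -- The two increasing pairs would coincide in reversed order.
  choose-injective false true  c d p q =
    contradiction (subst₂ Fin._<_ p q (low<high c)) (ℕ.<-asym (low<high d))
  choose-injective true  false c d p q =
    contradiction (subst₂ Fin._<_ q p (low<high c)) (ℕ.<-asym (low<high d))

  choose-not : ∀ a c → choose a c ≢ choose (not a) c
  choose-not false c = Fin.<⇒≢ (low<high c)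
  choose-not true  c = Fin.<⇒≢ (low<high c) ∘ sym

  -- Coordinate 0 differs between twins, so it can decide which of them receives the larger label.
  label : Bits (suc n) → Fin m
  label v = choose (lookup v zero) (colour v)

  label-comp : ∀ v → label (comp v) ≡ choose (not (lookup v zero)) (colour v)
  label-comp v = cong₂ choose (lookup-map zero not v) (colour-≈ (comp-≈ v))

  label≢label-comp : ∀ v → label (comp v) ≢ label v
  label≢label-comp v e = choose-not (lookup v zero) (colour v) (trans (sym e) (label-comp v))

  -- A label-preserving automorphism maps twins to twins, hence preserves the pair of labels and so
  -- the colour. Once it fixes all classes, it cannot exchange twins, whose labels differ.
  distinguishing :
    (∀ σ → IsAutomorphism (Hamming (suc n) k) σ →
      (∀ v → colour (Inverse.to σ v) ≡ colour v) → ∀ v → Inverse.to σ v ≈ v) →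
    HasDistinguishingLabeling (Hamming (suc n) k) m
  distinguishing fixes = label , λ σ auto invariant v →
    let open Inverse σ using (to)
        open Automorphism σ auto
        to-comp : ∀ v → to (comp v) ≡ comp (to v)
        to-comp v = case-≈ (to-≈ (comp-≈ v)) λ e → comp≢ v (to-injective e)
        colour-invariant : ∀ v → colour (to v) ≡ colour v
        colour-invariant v = choose-injective (lookup (to v) zero) (lookup v zero) _ _ (invariant v)
          (trans (sym (label-comp (to v))) (trans (cong label (sym (to-comp v)))
            (trans (invariant (comp v)) (label-comp v))))
    in case-≡ (fixes σ auto colour-invariant v) λ e →
         label≢label-comp v (trans (cong label (sym e)) (invariant v))
    where
    case-≈ : ∀ {u w : Bits (suc n)} → u ≈ w → u ≢ w → u ≡ comp w
    case-≈ (inj₁ p) ne = contradiction p ne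
    case-≈ (inj₂ p) ne = p
    case-≡ : ∀ {u w : Bits (suc n)} → u ≈ w → u ≢ comp w → u ≡ w
    case-≡ (inj₁ p) ne = p
    case-≡ (inj₂ p) ne = contradiction p ne

-- Labelings with m labels

module _ {N k : ℕ} (n≡2k : 2 + N ≡ k + k) where
  open Spokes k n≡2k

  spokes : Bits (2 + N) → Fin (suc N) → Bits (2 + N)
  spokes c zero    = c
  spokes c (suc j) = spoke j c

  odd-labelling : ∀ m → odd k ≡ true → 2 + N ≤ m C 2 →
    HasDistinguishingLabeling (Hamming (2 + N) k) m
  odd-labelling m odd-k 2+N≤ = distinguishing fixed
    where
    Q : Fin (suc N) → Bits (2 + N) → Set
    Q i v = v ≈ spokes 𝟎 i
    open Labelling k m n≡2k 2+N≤ Q (λ i v → v ≈? spokes 𝟎 i) (λ i p q → ≈-trans (≈-sym p) q)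
    module _ (σ : Bits (2 + N) ↔ Bits (2 + N)) (auto : IsAutomorphism (Hamming (2 + N) k) σ)
      (invariant : ∀ v → colour (Inverse.to σ v) ≡ colour v) where
      open SpokeAutomorphism σ auto
      spokes-fixed : ∀ i → Fixed (spokes 𝟎 i)
      spokes-fixed i with j , p , q ← first-common _ _ (sym (invariant (spokes 𝟎 i))) i ≈-refl =
        ≈-trans q (≈-sym p)
      even-part-fixed : ∀ v → Even v 𝟎 → Fixed v
      even-part-fixed = component-fixed (spokes-fixed zero) (spokes-fixed ∘ suc)
      fixed : ∀ v → Fixed v
      fixed v with even? v 𝟎
      ... | yes e = even-part-fixed v e
      -- All neighbours of `v` are even and so keep their classes; they are therefore neighbours of
      -- its image too.
      ... | no ne = neighbours⊆⇒≈ v (Inverse.to σ v) λ x p →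
        ~-≈ˡ (even-part-fixed x (odd-neighbour odd-k ne p)) (to-~ p)

  even-labelling : ∀ m → 3 + N ≤ m C 2 →
    HasDistinguishingLabeling (Hamming (2 + N) k) m
  even-labelling m 3+N≤ = distinguishing fixed
    where
    -- This is the unit vector e₀, the centre for the odd vertices, not the all-ones string.
    𝟏 : Bits (2 + N)
    𝟏 = flip zero 𝟎
    Q : Fin (2 + N) → Bits (2 + N) → Set
    Q zero    v = v ≈ 𝟎
    -- For `i = zero` this also admits `𝟎`, but `first` has already given `𝟎` the colour `zero`; the
    -- class of `𝟏` is thus alone in its colour.
    Q (suc i) v = v ≈ spokes 𝟎 i ⊎ v ≈ spokes 𝟏 i
    Q? : ∀ i v → Dec (Q i v)
    Q? zero    v = v ≈? 𝟎
    Q? (suc i) v = (v ≈? spokes 𝟎 i) ⊎-dec (v ≈? spokes 𝟏 i)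
    Q-≈ : ∀ i {u v} → u ≈ v → Q i u → Q i v
    Q-≈ zero    p q        = ≈-trans (≈-sym p) q
    Q-≈ (suc i) p (inj₁ q) = inj₁ (≈-trans (≈-sym p) q)
    Q-≈ (suc i) p (inj₂ q) = inj₂ (≈-trans (≈-sym p) q)
    open Labelling k m n≡2k 3+N≤ Q Q? Q-≈
    spokes-even : ∀ c i → Even (spokes c i) c
    spokes-even c zero    = even-self c
    spokes-even c (suc j) = spoke-even c j
    module _ (σ : Bits (2 + N) ↔ Bits (2 + N)) (auto : IsAutomorphism (Hamming (2 + N) k) σ)
      (invariant : ∀ v → colour (Inverse.to σ v) ≡ colour v) where
      open SpokeAutomorphism σ auto
      𝟎-fixed : Fixed 𝟎
      𝟎-fixed = first-zero (λ i → Q? i 𝟎) (λ i → Q? i (Inverse.to σ 𝟎)) (sym (invariant 𝟎)) ≈-refl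
      spokes-𝟎-fixed : ∀ i → Fixed (spokes 𝟎 i)
      spokes-𝟎-fixed i with first-common _ _ (sym (invariant (spokes 𝟎 i))) (suc i) (inj₁ ≈-refl)
      ... | zero  , p      , q      = ≈-trans q (≈-sym p)
      ... | suc j , inj₁ p , inj₁ q = ≈-trans q (≈-sym p)
      -- The mixed cases fail by parity: an automorphism fixing the class of `𝟎` preserves evenness,
      -- and the spokes of `𝟏` are odd.
      ... | suc j , inj₂ p , _      = contradiction (even-≈ p (spokes-even 𝟎 i)) (even-flip⇒odd zero (spokes-even 𝟏 j))
      ... | suc j , _      , inj₂ q =
        contradiction (even-≈ q (to-even 𝟎-fixed (spokes-even 𝟎 i))) (even-flip⇒odd zero (spokes-even 𝟏 j))
      spokes-𝟏-fixed : ∀ i → Fixed (spokes 𝟏 i)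
      spokes-𝟏-fixed i with first-common _ _ (sym (invariant (spokes 𝟏 i))) (suc i) (inj₂ ≈-refl)
      ... | zero  , p      , q      = ≈-trans q (≈-sym p)
      ... | suc j , inj₂ p , inj₂ q = ≈-trans q (≈-sym p)
      ... | suc j , inj₁ p , _      =
        contradiction (even-≈ (≈-sym p) (spokes-even 𝟎 j)) (even-flip⇒odd zero (spokes-even 𝟏 i))
      ... | suc j , _      , inj₁ q = contradiction
        (to-even⁻ 𝟎-fixed (even-≈ (≈-sym q) (spokes-even 𝟎 j))) (even-flip⇒odd zero (spokes-even 𝟏 i))
      fixed : ∀ v → Fixed v
      fixed v with even? v 𝟎
      ... | yes e = component-fixed 𝟎-fixed (spokes-𝟎-fixed ∘ suc) v e
      ... | no ne =
        component-fixed (spokes-𝟏-fixed zero) (spokes-𝟏-fixed ∘ suc) v (odd⇒even-flip zero ne)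

-- Two labels do not suffice

fin-collapse : ∀ {d} {a b c : Fin d} → d < 3 → a ≢ c → b ≢ c → a ≡ b
fin-collapse {a = zero}     {zero}                 _ _ _ = refl
fin-collapse {a = suc zero} {suc zero}             _ _ _ = refl
fin-collapse {a = zero}     {suc zero} {zero}      _ p _ = contradiction refl p
fin-collapse {a = suc zero} {zero}     {zero}      _ _ q = contradiction refl q
fin-collapse {a = suc zero} {zero}     {suc zero}  _ p _ = contradiction refl p
fin-collapse {a = zero}     {suc zero} {suc zero}  _ _ q = contradiction refl q
fin-collapse {a = suc (suc zero)}    (s≤s (s≤s (s≤s ())))
fin-collapse {a = suc (suc (suc _))} (s≤s (s≤s (s≤s ())))
fin-collapse {b = suc (suc zero)}    (s≤s (s≤s (s≤s ())))
fin-collapse {b = suc (suc (suc _))} (s≤s (s≤s (s≤s ())))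
fin-collapse {c = suc (suc zero)}    (s≤s (s≤s (s≤s ())))
fin-collapse {c = suc (suc (suc _))} (s≤s (s≤s (s≤s ())))

flip-≈ : (i : Fin n) {u v : Bits n} → u ≈ v → flip i u ≈ flip i v
flip-≈ i (inj₁ refl) = inj₁ refl
flip-≈ i (inj₂ refl) = inj₂ (flip-comp i _)

flip≉ : ∀ {N} (v : Bits (2 + N)) → ¬ (flip zero v ≈ v)
flip≉ (true  ∷ v)          (inj₁ ())
flip≉ (false ∷ v)          (inj₁ ())
flip≉ (x     ∷ true  ∷ v)  (inj₂ ())
flip≉ (x     ∷ false ∷ v)  (inj₂ ())

≈-label-injective : ∀ {A : Set} {f : Bits n → A} → (∀ v → f (comp v) ≢ f v) →
  ∀ {u v} → u ≈ v → f u ≡ f v → u ≡ v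
≈-label-injective ne (inj₁ p)    e = p
≈-label-injective ne (inj₂ refl) e = contradiction e (ne _)

module TwoLabels {N k d : ℕ} (n≡2k : 2 + N ≡ k + k) (d<3 : d < 3) (f : Bits (2 + N) → Fin d)
  (distinguishes : IsDistinguishing (Hamming (2 + N) k) d f) where
  open Orthogonality k n≡2k

  involution-trivial : (g : Bits (2 + N) → Bits (2 + N)) → (∀ v → g (g v) ≡ v) →
    (∀ {u v} → u ~ v → g u ~ g v) → (∀ v → f (g v) ≡ f v) → ∀ v → g v ≡ v
  involution-trivial g gg g-~ fg =
    distinguishes (mk↔ₛ′ g g gg gg) (λ u v → preserves u v , reflects u v) fg
    where
    preserves : ∀ u v → hamming u v ≡ k → hamming (g u) (g v) ≡ k
    preserves u v p = trans (hamming-wt (g u) (g v))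
      (_~_.wt≡k (g-~ (orthogonal (trans (sym (hamming-wt u v)) p))))
    reflects : ∀ u v → hamming (g u) (g v) ≡ k → hamming u v ≡ k
    reflects u v p = subst₂ (λ a b → hamming a b ≡ k) (gg u) (gg v) (preserves (g u) (g v) p)

  swap : Bits (2 + N) → Bits (2 + N) → Bits (2 + N)
  swap w v with v ≈? w
  ... | yes _ = comp v
  ... | no  _ = v

  swap-≈ : ∀ w v → swap w v ≈ v
  swap-≈ w v with v ≈? w
  ... | yes _ = comp-≈ v
  ... | no  _ = ≈-refl

  swap-yes : ∀ w v → v ≈ w → swap w v ≡ comp v
  swap-yes w v p with v ≈? w
  ... | yes _ = refl
  ... | no ¬p = contradiction p ¬p

  swap-no : ∀ w v → ¬ (v ≈ w) → swap w v ≡ v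
  swap-no w v ¬p with v ≈? w
  ... | yes p = contradiction p ¬p
  ... | no  _ = refl

  swap-involutive : ∀ w v → swap w (swap w v) ≡ v
  swap-involutive w v with v ≈? w
  ... | yes p = trans (swap-yes w (comp v) (≈-trans (comp-≈ v) p)) (comp-involutive v)
  ... | no ¬p = swap-no w v ¬p

  swap-label : ∀ w → f (comp w) ≡ f w → ∀ v → f (swap w v) ≡ f v
  swap-label w e v with v ≈? w
  ... | yes (inj₁ refl) = e
  ... | yes (inj₂ refl) = trans (cong f (comp-involutive w)) (sym e)
  ... | no  _           = refl

  -- Otherwise `swap w` preserves labels. It moves vertices only within their twin classes, so it
  -- also preserves adjacency, yet it moves `w`.
  twins-differ : ∀ w → f (comp w) ≢ f w
  twins-differ w e = comp≢ w (trans (sym (swap-yes w w ≈-refl))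
    (involution-trivial (swap w) (swap-involutive w)
      (λ {u} {v} p → ~-≈ˡ (≈-sym (swap-≈ w u)) (~-≈ʳ (≈-sym (swap-≈ w v)) p))
      (swap-label w e) w))

  -- Any automorphism of the graph of twin classes would do in place of flip zero.
  lift : Bits (2 + N) → Bits (2 + N)
  lift v with f (flip zero v) Fin.≟ f v
  ... | yes _ = flip zero v
  ... | no  _ = comp (flip zero v)

  lift-≈ : ∀ v → lift v ≈ flip zero v
  lift-≈ v with f (flip zero v) Fin.≟ f v
  ... | yes _ = ≈-refl
  ... | no  _ = comp-≈ _

  lift-label : ∀ v → f (lift v) ≡ f v
  lift-label v with f (flip zero v) Fin.≟ f v
  ... | yes e = e
  -- Both `f v` and the label of the twin of `flip zero v` differ from `f (flip zero v)`; with at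
  -- most two labels they are equal.
  ... | no ne = fin-collapse d<3 (twins-differ (flip zero v)) (ne ∘ sym)

  -- Applying `lift` twice returns to the twin class of `v` with the label of `v`, and twins have
  -- different labels.
  lift-involutive : ∀ v → lift (lift v) ≡ v
  lift-involutive v = ≈-label-injective twins-differ
    (≈-trans (lift-≈ (lift v)) (subst (flip zero (lift v) ≈_) (flip-involutive zero v)
      (flip-≈ zero (lift-≈ v))))
    (trans (lift-label (lift v)) (lift-label v))

  flip-~ : ∀ {u v} → u ~ v → flip zero u ~ flip zero v
  flip-~ {u} {v} (orthogonal p) = orthogonal (trans (cong wt (trans (⊕-flip zero _ v)
    (trans (cong (flip zero) (flip-⊕ zero u v)) (flip-involutive zero (u ⊕ v))))) p)

  impossible : ⊥
  impossible = flip≉ 𝟎 (≈-trans (≈-sym (lift-≈ 𝟎)) (inj₁ (involution-trivial lift lift-involutive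
    (λ {u} {v} p → ~-≈ˡ (≈-sym (lift-≈ u)) (~-≈ʳ (≈-sym (lift-≈ v)) (flip-~ p)))
    lift-label 𝟎)))

-- Decidability of having a distinguishing labelling

Dec∃ : Set → Set₁
Dec∃ A = {P : A → Set} → (∀ a → Dec (P a)) → Dec (∃ P)

any-bits? : ∀ n → Dec∃ (Bits n)
any-bits? zero    P? = map′ (λ p → [] , p) (λ { ([] , p) → p }) (P? [])
any-bits? (suc n) P? = map′
  (λ { (inj₁ (v , p)) → false ∷ v , p ; (inj₂ (v , p)) → true ∷ v , p })
  (λ { (false ∷ v , p) → inj₁ (v , p) ; (true ∷ v , p) → inj₂ (v , p) })
  (any-bits? n (λ v → P? (false ∷ v)) ⊎-dec any-bits? n (λ v → P? (true ∷ v)))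

all-bits? : {P : Bits n → Set} → (∀ v → Dec (P v)) → Dec (∀ v → P v)
all-bits? {n} P? = map′ (λ ne v → decidable-stable (P? v) λ ¬p → ne (v , ¬p))
  (λ { h (v , ¬p) → ¬p (h v) }) (¬? (any-bits? n (λ v → ¬? (P? v))))

join : {A : Set} → (Bits n → A) → (Bits n → A) → Bits (suc n) → A
join g h (false ∷ v) = g v
join g h (true  ∷ v) = h v

-- A function on `Bits (suc n)` is a pair of functions on `Bits n`, but only up to pointwise
-- equality, which `P` must therefore respect.
any-function? : ∀ {A : Set} → Dec∃ A → ∀ n {P : (Bits n → A) → Set} →
  (∀ {f g} → f ≗ g → P f → P g) → (∀ f → Dec (P f)) → Dec (∃ P)
any-function? any-A? zero    resp P? = map′ (λ { (a , p) → (λ _ → a) , p })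
  (λ { (f , p) → f [] , resp (λ { [] → refl }) p }) (any-A? (λ a → P? (λ _ → a)))
any-function? any-A? (suc n) {P} resp P? = map′ (λ { (g , h , p) → join g h , p })
  (λ { (f , p) → (λ v → f (false ∷ v)) , (λ v → f (true ∷ v))
     , resp (λ { (false ∷ v) → refl ; (true ∷ v) → refl }) p })
  (any-function? any-A? n {λ g → ∃ λ h → P (join g h)}
    (λ { e (h , p) → h , resp (λ { (false ∷ v) → e v ; (true ∷ v) → refl }) p })
    λ g → any-function? any-A? n
      (λ e → resp λ { (false ∷ v) → refl ; (true ∷ v) → e v }) (λ h → P? (join g h)))

module _ {n k d : ℕ} where
  private
    G = Hamming n k

  -- A counterexample to `f` being distinguishing, with the bijection given by two plain functions
  -- so that a finite search can run over both.
  record Breaks (f : Bits n → Fin d) (to from : Bits n → Bits n) : Set where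
    constructor breaks
    field
      to-from   : ∀ v → to (from v) ≡ v
      from-to   : ∀ v → from (to v) ≡ v
      preserves : ∀ u v → hamming u v ≡ k → hamming (to u) (to v) ≡ k
      reflects  : ∀ u v → hamming (to u) (to v) ≡ k → hamming u v ≡ k
      label     : ∀ v → f (to v) ≡ f v
      moves     : ∃ λ v → to v ≢ v

  breaks? : ∀ f to from → Dec (Breaks f to from)
  breaks? f to from = map′
    (λ { (a , b , c , d , e , g) → breaks a b c d e g })
    (λ { (breaks a b c d e g) → a , b , c , d , e , g })
    (all-bits? (λ v → to (from v) ≟ v) ×-dec
     all-bits? (λ v → from (to v) ≟ v) ×-dec
     all-bits? (λ u → all-bits? λ v →
       (hamming u v Data.Nat.≟ k) →-dec (hamming (to u) (to v) Data.Nat.≟ k)) ×-dec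
     all-bits? (λ u → all-bits? λ v →
       (hamming (to u) (to v) Data.Nat.≟ k) →-dec (hamming u v Data.Nat.≟ k)) ×-dec
     all-bits? (λ v → f (to v) Fin.≟ f v) ×-dec
     any-bits? n (λ v → ¬? (to v ≟ v)))

  breaks-cong : ∀ {f to to' from from'} → to ≗ to' → from ≗ from' →
    Breaks f to from → Breaks f to' from'
  breaks-cong {f} {to} {to'} {from} {from'} e e' (breaks a b c d g (v , m)) = breaks
    (λ v → trans (sym (trans (cong to (e' v)) (e (from' v)))) (a v))
    (λ v → trans (sym (trans (cong from (e v)) (e' (to' v)))) (b v))
    (λ u v p → subst₂ (λ x y → hamming x y ≡ k) (e u) (e v) (c u v p))
    (λ u v p → d u v (subst₂ (λ x y → hamming x y ≡ k) (sym (e u)) (sym (e v)) p))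
    (λ v → trans (cong f (sym (e v))) (g v))
    (v , λ p → m (trans (e v) p))

  distinguishing? : ∀ f → Dec (IsDistinguishing G d f)
  distinguishing? f = map′ unbroken⇒distinguishing distinguishing⇒unbroken
    (¬? (any-function? (any-bits? n) n {λ to → ∃ λ from → Breaks f to from}
      (λ { e (from , b) → from , breaks-cong e (λ _ → refl) b })
      λ to → any-function? (any-bits? n) n (breaks-cong (λ _ → refl)) (breaks? f to)))
    where
    unbroken⇒distinguishing : ¬ (∃ λ to → ∃ λ from → Breaks f to from) → IsDistinguishing G d f
    unbroken⇒distinguishing ¬b σ auto inv v = decidable-stable (to v ≟ v) λ ne →
      ¬b (to , from , breaks strictlyInverseˡ strictlyInverseʳ
        (λ u v → proj₁ (auto u v)) (λ u v → proj₂ (auto u v)) inv (v , ne))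
      where open Inverse σ
    distinguishing⇒unbroken : IsDistinguishing G d f → ¬ (∃ λ to → ∃ λ from → Breaks f to from)
    distinguishing⇒unbroken h (to , from , breaks a b c e g (v , m)) =
      m (h (mk↔ₛ′ to from a b) (λ u v → c u v , e u v) g v)

  hasDistinguishingLabeling? : Dec (HasDistinguishingLabeling G d)
  hasDistinguishingLabeling? = any-function? Fin.any? n
    (λ e h σ auto inv → h σ auto λ v → trans (e _) (trans (inv v) (sym (e v)))) distinguishing?

-- The least number of labels and its bounds

least : {P : ℕ → Set} → (∀ d → Dec (P d)) → ∀ m → P m → ∃ λ d → P d × (∀ d' → d' < d → ¬ P d')
least P? m p with P? 0
least P? m       p | yes p₀ = 0 , p₀ , λ _ ()
least P? zero    p | no ¬p₀ = contradiction p ¬p₀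
least P? (suc m) p | no ¬p₀ with d , pd , below ← least (P? ∘ suc) m p =
  suc d , pd , λ { zero _ → ¬p₀ ; (suc d') (s≤s lt) → below d' lt }

odd-%2 : ∀ k → odd k ≡ odd (k % 2)
odd-%2 k = begin
  odd k                                  ≡⟨ cong odd (m≡m%n+[m/n]*n k 2) ⟩
  odd (k % 2 + k / 2 * 2)                ≡⟨ odd-+ (k % 2) _ ⟩
  odd (k % 2) xor odd (k / 2 * 2)        ≡⟨ cong (λ q → odd (k % 2) xor odd q) q*2≡q+q ⟩
  odd (k % 2) xor odd (k / 2 + k / 2)    ≡⟨ cong (odd (k % 2) xor_) (odd-double (k / 2)) ⟩
  odd (k % 2) xor false                  ≡⟨ xor-identityʳ _ ⟩
  odd (k % 2)                            ∎
  where
  open ≡-Reasoning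
  q*2≡q+q : k / 2 * 2 ≡ k / 2 + k / 2
  q*2≡q+q = trans (ℕ.*-comm (k / 2) 2) (cong (k / 2 +_) (ℕ.+-identityʳ _))

labelling : ∀ {N} k m → 2 + N ≡ 2 * k → threshold k ≤ m C 2 →
  HasDistinguishingLabeling (Hamming (2 + N) k) m
-- Abstracting `k % 2` reduces `threshold k` and makes `odd-%2 k` state the parity of `k` in each
-- branch.
labelling k m e le with k % 2 in r | odd-%2 k | m%n<n k 2
... | zero        | _     | _ =
  even-labelling (trans e (cong (k +_) (ℕ.+-identityʳ k))) m
    (subst (_≤ m C 2) (trans (+-comm (2 * k) 1) (cong suc (sym e))) le)
... | suc zero    | odd-k | _ =
  odd-labelling (trans e (cong (k +_) (ℕ.+-identityʳ k))) m odd-k (subst (_≤ m C 2) (sym e) le)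
... | suc (suc _) | _     | s≤s (s≤s ())

dist-bounds : ∀ {N} k m → 2 + N ≡ 2 * k → threshold k ≤ m C 2 →
  Σ ℕ (λ d → IsDist (Hamming (2 + N) k) d × (2 < d × d ≤ m))
dist-bounds {N} k m e le =
  bound (least {HasDistinguishingLabeling (Hamming (2 + N) k)} (λ _ → hasDistinguishingLabeling?) m
    (labelling k m e le))
  where
  bound : ∃ (IsDist (Hamming (2 + N) k)) →
    Σ ℕ (λ d → IsDist (Hamming (2 + N) k) d × (2 < d × d ≤ m))
  bound (d , (f , distinguishes) , below) = d , ((f , distinguishes) , below)
    , ℕ.≰⇒> (λ d≤2 → TwoLabels.impossible (trans e (cong (k +_) (ℕ.+-identityʳ k)))
        (s≤s d≤2) f distinguishes)
    , ℕ.≮⇒≥ (λ m<d → below m m<d (labelling k m e le))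

theorem4 : (k m : ℕ) → 1 ≤ k → IsLeastM k m →
    Σ ℕ (λ d → IsDist (Ω k) d × (2 < d × d ≤ m))
theorem4 (suc k) m _ (le , _) =
  -- The length is brought into the form `2 + N` with `N = 2 * k`, then carried back.
  subst (λ n → Σ ℕ (λ d → IsDist (Hamming n (suc k)) d × (2 < d × d ≤ m))) e
    (dist-bounds (suc k) m e le)
  where
  e : 2 + 2 * k ≡ 2 * suc k
  e = sym (ℕ.*-suc 2 k)
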